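{- For any Boolean function $f:\{0,1\}^n\times\{0,1\}^n\to\{0,1\}$, $\mathrm{spd}(f)=\mathrm{bc}(G_f)$ and $\mathrm{uspd}(f)=\mathrm{bp}(G_f)$.
   Context: Bipartite realization: $G_f=(U,V,E)$ is the bipartite graph with $U=V=\{0,1\}^n$ (as disjoint sides) and $(u,v)\in E$ iff $f(u,v)=1$. Standard projective dimension: $\mathrm{spd}(f)$ (over a field $\mathbb{F}$) is the smallest $d$ such that there is a map $\phi$ assigning to each vertex of $U\cup V$ a subspace of $\mathbb{F}^d$ spanned by a subset of the standard basis vectors, such that for all $(u,v)\in U\times V$: $\phi(u)\cap\phi(v)\ne\{0\}$ iff $(u,v)\in E$. $\mathrm{uspd}(f)$ is the smallest $d$ for which such a $\phi$ exists with, in addition, $\dim(\phi(u)\cap\phi(v))\le 1$ for all $(u,v)\in U\times V$. Biclique cover number: $\mathrm{bc}(G)$ is the smallest size of a collection of complete bipartite subgraphs of $G$ such that every edge of $G$ lies in some member of the collection. Biclique partition number: $\mathrm{bp}(G)$ is the smallest size of such a collection whose members are moreover pairwise edge-disjoint. -}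

module Defs where

open import Algebra.Apartness.Bundles using (HeytingField; HeytingCommutativeRing)
open import Algebra.Bundles using (CommutativeRing)
import Algebra.Properties.Monoid.Sum as Sum
open import Data.Bool.Base using (Bool; true; T; if_then_else_)
open import Data.Fin.Base using (Fin)
open import Data.Fin.Properties using (_≟_)
open import Data.Fin.Subset using (Subset)
import Data.Fin.Subset as FinSubset
open import Data.Nat.Base using (ℕ; _≤_)
open import Data.Product.Base using (_×_; _,_; ∃-syntax)
open import Data.Sum.Base using (_⊎_; inj₁; inj₂)
open import Data.Vec.Base using (Vec)
open import Data.Vec.Functional using (Vector)
import Data.Vec.Functional.Relation.Binary.Equality.Setoid as VectorEquality
open import Function.Bundles using (_⇔_)
open import Level using (Level; _⊔_; 0ℓ) renaming (suc to lsuc)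
open import Relation.Binary.Core using (REL)
open import Relation.Binary.PropositionalEquality.Core using (_≡_; _≢_)
open import Relation.Nullary.Decidable.Core using (does)
open import Relation.Nullary.Negation.Core using (¬_)
open import Relation.Unary using (Pred; _∈_; _∩_; _≐_)

IsLeast : {p : Level} → Pred ℕ p → Pred ℕ p
IsLeast P d = P d × (∀ m → P m → d ≤ m)

record BipartiteGraph : Set₁ where
  field
    U V : Set
    E   : REL U V 0ℓ

  Vertex : Set
  Vertex = U ⊎ V

BooleanFunction : ℕ → Set
BooleanFunction n = Vec Bool n × Vec Bool n → Bool

realization : {n : ℕ} → BooleanFunction n → BipartiteGraph
realization {n} f = record
  { U = Vec Bool n
  ; V = Vec Bool n
  ; E = λ u v → f (u , v) ≡ true
  }

module _ (G : BipartiteGraph) where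
  open BipartiteGraph G

  -- A complete bipartite subgraph is determined by its two vertex sets, given
  -- here by their characteristic functions; its edge set is all of L × R.
  -- Empty sides are allowed: dropping members without edges never hurts, so
  -- this does not affect the cover and partition numbers.
  record Biclique : Set where
    field
      L        : U → Bool
      R        : V → Bool
      complete : ∀ u v → T (L u) → T (R v) → E u v

    Edge : REL U V 0ℓ
    Edge u v = T (L u) × T (R v)

  open Biclique using (Edge)

  Covers : {k : ℕ} → (Fin k → Biclique) → Set
  Covers B = ∀ u v → E u v → ∃[ i ] Edge (B i) u v

  EdgeDisjoint : {k : ℕ} → (Fin k → Biclique) → Set
  EdgeDisjoint B = ∀ i j → i ≢ j → ∀ u v → ¬ (Edge (B i) u v × Edge (B j) u v)

  HasBicliqueCover : Pred ℕ 0ℓ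
  HasBicliqueCover k = ∃[ B ] Covers {k} B

  HasBicliquePartition : Pred ℕ 0ℓ
  HasBicliquePartition k = ∃[ B ] (Covers {k} B × EdgeDisjoint B)

  IsBc : Pred ℕ 0ℓ
  IsBc = IsLeast HasBicliqueCover

  IsBp : Pred ℕ 0ℓ
  IsBp = IsLeast HasBicliquePartition

-- HeytingField is the library's notion of field. Classically every field is one,
-- with _≉_ as its apartness, and 1# ≉ 0# follows from its axioms.
module LinearAlgebra {c ℓ₁ ℓ₂ : Level} (F : HeytingField c ℓ₁ ℓ₂) where
  open HeytingField F using (heytingCommutativeRing)
  open HeytingCommutativeRing heytingCommutativeRing using (commutativeRing)
  open CommutativeRing commutativeRing
    using (Carrier; _≈_; _+_; _*_; 0#; 1#; setoid; +-monoid)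
  open Sum +-monoid using (sum)
  open VectorEquality setoid public using (_≋_)

  Space : ℕ → Set c
  Space d = Vector Carrier d

  0ᵛ : {d : ℕ} → Space d
  0ᵛ j = 0#

  infixl 6 _+ᵛ_
  _+ᵛ_ : {d : ℕ} → Space d → Space d → Space d
  (x +ᵛ y) j = x j + y j

  infixr 7 _*ᵛ_
  _*ᵛ_ : {d : ℕ} → Carrier → Space d → Space d
  (a *ᵛ x) j = a * x j

  linearCombination : {d k : ℕ} → Vector Carrier k → Vector (Space d) k → Space d
  linearCombination a b j = sum (λ i → a i * b i j)

  Span : {d : ℕ} {p : Level} → Pred (Space d) p → Pred (Space d) (c ⊔ ℓ₁ ⊔ p)
  Span {d} P x =
    ∃[ k ] ∃[ a ] ∃[ b ] ((∀ i → b i ∈ P) × x ≋ linearCombination {d} {k} a b)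

  record Subspace (d : ℕ) : Set (lsuc (c ⊔ ℓ₁)) where
    field
      Member   : Pred (Space d) (c ⊔ ℓ₁)
      resp-≋   : ∀ {x y} → x ≋ y → x ∈ Member → y ∈ Member
      0-closed : 0ᵛ ∈ Member
      +-closed : ∀ {x y} → x ∈ Member → y ∈ Member → x +ᵛ y ∈ Member
      *-closed : ∀ a {x} → x ∈ Member → a *ᵛ x ∈ Member

  open Subspace public using (Member)

  Zero : {d : ℕ} → Pred (Space d) ℓ₁
  Zero x = x ≋ 0ᵛ

  LinearlyIndependent : {d k : ℕ} → Vector (Space d) k → Set (c ⊔ ℓ₁)
  LinearlyIndependent b =
    ∀ a → linearCombination a b ≋ 0ᵛ → ∀ i → a i ≈ 0#

  Range : {d k : ℕ} → Vector (Space d) k → Pred (Space d) ℓ₁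
  Range b x = ∃[ i ] x ≋ b i

  IsBasis : {d k : ℕ} {p : Level} → Pred (Space d) p → Vector (Space d) k → Set (c ⊔ ℓ₁ ⊔ p)
  IsBasis W b = LinearlyIndependent b × W ≐ Span (Range b)

  HasDimension : {d : ℕ} {p : Level} → Pred (Space d) p → ℕ → Set (c ⊔ ℓ₁ ⊔ p)
  HasDimension {d} W k = ∃[ b ] IsBasis {d} {k} W b

  standardBasis : {d : ℕ} → Vector (Space d) d
  standardBasis i j = if does (i ≟ j) then 1# else 0#

  StandardVectors : {d : ℕ} → Subset d → Pred (Space d) ℓ₁
  StandardVectors S x = ∃[ i ] (i FinSubset.∈ S × x ≋ standardBasis i)

  IsStandard : {d : ℕ} → Subspace d → Set (c ⊔ ℓ₁)
  IsStandard W = ∃[ S ] (Member W ≐ Span (StandardVectors S))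

module _ {c ℓ₁ ℓ₂ : Level} (F : HeytingField c ℓ₁ ℓ₂) {n : ℕ} (f : BooleanFunction n) where
  open LinearAlgebra F
  open BipartiteGraph (realization f)

  IsStandardRealization : {d : ℕ} → (Vertex → Subspace d) → Set (c ⊔ ℓ₁)
  IsStandardRealization φ =
    (∀ x → IsStandard (φ x)) ×
    (∀ u v → (¬ (Member (φ (inj₁ u)) ∩ Member (φ (inj₂ v)) ≐ Zero)) ⇔ E u v)

  IntersectionsAtMostLines : {d : ℕ} → (Vertex → Subspace d) → Set (c ⊔ ℓ₁)
  IntersectionsAtMostLines φ =
    ∀ u v → ∃[ k ] (HasDimension (Member (φ (inj₁ u)) ∩ Member (φ (inj₂ v))) k × k ≤ 1)

  HasStandardRealization : Pred ℕ (lsuc (c ⊔ ℓ₁))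
  HasStandardRealization d = ∃[ φ ] IsStandardRealization {d} φ

  HasUnambiguousStandardRealization : Pred ℕ (lsuc (c ⊔ ℓ₁))
  HasUnambiguousStandardRealization d =
    ∃[ φ ] (IsStandardRealization {d} φ × IntersectionsAtMostLines φ)

  IsSpd : Pred ℕ (lsuc (c ⊔ ℓ₁))
  IsSpd = IsLeast HasStandardRealization

  IsUspd : Pred ℕ (lsuc (c ⊔ ℓ₁))
  IsUspd = IsLeast HasUnambiguousStandardRealization

{-# OPTIONS --safe #-}

-- All four numbers are governed by one finite object: a labelling S of the
-- vertices by subsets of a k-element set such that uv is an edge iff S u and S v
-- meet.  The i-th biclique consists of the vertices whose label contains i, and
-- the subspace φ x is spanned by the standard vectors indexed by S x; bicliques
-- are edge-disjoint, and intersections at most lines, exactly when labels of the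
-- two sides share at most one element.  There are finitely many labellings for
-- each k and stars give one for k = 2ⁿ, so the least k exists constructively.

module Submission where

open import Defs
open import Algebra.Apartness.Bundles using (HeytingField; HeytingCommutativeRing)
open import Algebra.Bundles using (CommutativeRing)
import Algebra.Properties.Ring as RingProperties
import Algebra.Properties.Semiring.Sum as SemiringSum
open import Data.Bool.Base using (Bool; true; T; if_then_else_)
import Data.Bool.Properties as Bool
open import Data.Fin.Base using (Fin; zero; suc; finToFun; funToFin)
open import Data.Fin.Properties
  using (_≟_; all?; any?; finToFun-funToFin; 2↔Bool; +↔⊎)
open import Data.Fin.Subset as Subset using (Subset; Nonempty; ⁅_⁆)
open import Data.Fin.Subset.Properties
  using ( _∈?_; nonempty?; anySubset?; p∩q⊆p; p∩q⊆q; x∈p∩q⁺; ∩⇔×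
        ; x∈⁅x⁆; x∈⁅y⁆⇒x≡y )
open import Data.Nat.Base using (ℕ; zero; suc; _+_; _^_; _≤_; _<_; z≤n; s≤s)
open import Data.Nat.Induction using (<-rec)
open import Data.Nat.Properties using (anyUpTo?; ≮⇒≥)
open import Data.Product.Base using (_×_; _,_; Σ-syntax; ∃-syntax; proj₁; proj₂; uncurry; map₂)
open import Data.Product.Function.NonDependent.Propositional using (_×-⇔_)
open import Data.Sum.Base using (_⊎_; inj₁; inj₂)
open import Data.Sum.Function.Propositional using (_⊎-↪_)
open import Data.Vec.Base using (Vec; lookup; tabulate)
open import Data.Vec.Functional using (Vector; _∷_)
open import Data.Vec.Properties
  using (lookup∘tabulate; tabulate∘lookup; tabulate-cong; []=⇒lookup; lookup⇒[]=)
open import Function.Base using (_∘_; id)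
open import Function.Bundles using (_⇔_; mk⇔; Equivalence; _↪_; mk↪; RightInverse)
open import Function.Construct.Composition using (_⇔-∘_; _↪-∘_)
open import Function.Construct.Symmetry using (⇔-sym; ↔-sym)
open import Function.Properties.Inverse using (↔⇒↪)
open import Level using (Level; 0ℓ)
open import Relation.Binary.PropositionalEquality as ≡ using (_≡_; _≢_; _≗_; subst; subst₂)
open import Relation.Nullary using (¬_; Dec; yes; no; contradiction)
open import Relation.Nullary.Decidable
  using (map′; ¬?; _×-dec_; _→-dec_; decidable-stable; dec-true; dec-false)
open import Relation.Unary using (Pred; Decidable; _∈_; _⊆_; _∩_; _≐_; Satisfiable)

open Equivalence using (to; from)

private
  variable
    a p q : Level
    X Y : Set a
    d k m n : ℕ

-- Least witnesses and searches over finite types.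

leastOf : {P : Pred ℕ p} → Decidable P → ∃⟨ P ⟩ → ∃⟨ IsLeast P ⟩
leastOf {P = P} P? (k , Pk) = <-rec (λ k → P k → ∃⟨ IsLeast P ⟩) step k Pk
  where
  step : ∀ k → (∀ {m} → m < k → P m → ∃⟨ IsLeast P ⟩) → P k → ∃⟨ IsLeast P ⟩
  step k rec Pk with anyUpTo? P? k
  ... | yes (m , m<k , Pm) = rec m<k Pm
  ... | no none = k , Pk , λ m Pm → ≮⇒≥ λ m<k → none (m , m<k , Pm)

-- Turns a size-by-size equivalence of existence predicates into equality of the two minima.
isLeast-resp-⇔ : {P : Pred ℕ p} {Q : Pred ℕ q} → (∀ {k} → P k ⇔ Q k) →
                 IsLeast P d → IsLeast Q d
isLeast-resp-⇔ P⇔Q (Pd , d≤) = to P⇔Q Pd , λ m → d≤ m ∘ from P⇔Q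

boolVec↪Fin : Vec Bool n ↪ Fin (2 ^ n)
boolVec↪Fin = mk↪ {to = encode} {from = decode} λ { ≡.refl → decode∘encode _ }
  where
  module Bit = RightInverse (↔⇒↪ (↔-sym 2↔Bool))

  encode : Vec Bool n → Fin (2 ^ n)
  encode v = funToFin (Bit.to ∘ lookup v)

  decode : Fin (2 ^ n) → Vec Bool n
  decode i = tabulate (Bit.from ∘ finToFun i)

  decode∘encode : (v : Vec Bool n) → decode (encode v) ≡ v
  decode∘encode v = ≡.trans
    (tabulate-cong λ j → ≡.trans (≡.cong Bit.from (finToFun-funToFin _ j))
                                 (Bit.strictlyInverseʳ _))
    (tabulate∘lookup v)

-- Functions are coded by the elements of `Fin (n ^ m)`. Decoding recovers a function only
-- pointwise, hence the assumption that `P` respects `_≗_`.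
anyFunction? : X ↪ Fin m → Y ↪ Fin n → {P : Pred (X → Y) p} →
               (∀ {g h} → g ≗ h → P g → P h) → Decidable P → Dec ∃⟨ P ⟩
anyFunction? {X = X} {m = m} {Y = Y} {n = n} X↪ Y↪ {P} resp P? = map′
  (λ { (i , Pi) → decode i , Pi })
  (λ { (g , Pg) → encode g , resp (≡.sym ∘ decode∘encode g) Pg })
  (any? (P? ∘ decode))
  where
  module X = RightInverse X↪
  module Y = RightInverse Y↪

  decode : Fin (n ^ m) → X → Y
  decode i = Y.from ∘ finToFun i ∘ X.to

  encode : (X → Y) → Fin (n ^ m)
  encode g = funToFin (Y.to ∘ g ∘ X.from)

  decode∘encode : ∀ g → decode (encode g) ≗ g
  decode∘encode g x = ≡.trans
    (≡.cong Y.from (finToFun-funToFin (Y.to ∘ g ∘ X.from) (X.to x)))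
    (≡.trans (Y.strictlyInverseʳ _) (≡.cong g (X.strictlyInverseʳ x)))

allSubset? : {P : Pred (Subset n) p} → Decidable P → Dec (∀ s → P s)
allSubset? P? = map′
  (λ none s → decidable-stable (P? s) λ ¬Ps → none (s , ¬Ps))
  (λ { all (s , ¬Ps) → ¬Ps (all s) })
  (¬? (anySubset? (¬? ∘ P?)))

_⇔-dec_ : {X : Set p} {Y : Set q} → Dec X → Dec Y → Dec (X ⇔ Y)
X? ⇔-dec Y? = map′ (uncurry mk⇔) (λ e → to e , from e)
  ((X? →-dec Y?) ×-dec (Y? →-dec X?))

-- Subsets with at most one element, and characteristic functions.

AtMostOne : Subset k → Set
AtMostOne s = ∀ i j → i Subset.∈ s → j Subset.∈ s → i ≡ j

atMostOne? : Decidable (AtMostOne {k})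
atMostOne? s = all? λ i → all? λ j → (i ∈? s) →-dec ((j ∈? s) →-dec (i ≟ j))

T-lookup⇔∈ : (s : Subset k) (i : Fin k) → T (lookup s i) ⇔ i Subset.∈ s
T-lookup⇔∈ s i = mk⇔ (lookup⇒[]= i s ∘ to Bool.T-≡) (from Bool.T-≡ ∘ []=⇒lookup)

T⇔∈-tabulate : (b : Fin k → Bool) (i : Fin k) → T (b i) ⇔ i Subset.∈ tabulate b
T⇔∈-tabulate b i =
  subst (λ x → T x ⇔ i Subset.∈ tabulate b) (lookup∘tabulate b i)
        (T-lookup⇔∈ (tabulate b) i)

-- Labellings of the vertices by finite subsets.

module _ {n : ℕ} (f : BooleanFunction n) where
  open BipartiteGraph (realization f)

  Label : ℕ → Set
  Label k = Vertex → Subset k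

  infix 9 _⟨_∩_⟩
  _⟨_∩_⟩ : Label k → U → V → Subset k
  S ⟨ u ∩ v ⟩ = S (inj₁ u) Subset.∩ S (inj₂ v)

  -- The size `k` is quantified inside, so that a single property speaks of labellings of every
  -- size.
  Property : Set₁
  Property = U → V → ∀ {k} → Pred (Subset k) 0ℓ

  Meeting MeetingOnce : Property
  Meeting     u v s = Nonempty s ⇔ E u v
  MeetingOnce u v s = Meeting u v s × AtMostOne s

  HasLabelling : Property → Pred ℕ 0ℓ
  HasLabelling Q k = Σ[ S ∈ Label k ] (∀ u v → Q u v (S ⟨ u ∩ v ⟩))

  hasLabelling? : (Q : Property) → (∀ u v {k} → Decidable (Q u v {k})) →
                  Decidable (HasLabelling Q)
  hasLabelling? Q Q? k = anyFunction? vertex↪Fin boolVec↪Fin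
    (λ S≗S′ valid u v →
      subst₂ (λ s t → Q u v (s Subset.∩ t)) (S≗S′ (inj₁ u)) (S≗S′ (inj₂ v)) (valid u v))
    -- `U` and `V` are `Vec Bool n`, which is `Subset n` by definition, so subset search decides
    -- both quantifiers.
    (λ S → allSubset? λ u → allSubset? λ v → Q? u v _)
    where
    vertex↪Fin : Vertex ↪ Fin (2 ^ n + 2 ^ n)
    vertex↪Fin = ↔⇒↪ (↔-sym +↔⊎) ↪-∘ (boolVec↪Fin ⊎-↪ boolVec↪Fin)

  meeting? : ∀ u v {k} → Decidable (Meeting u v {k})
  meeting? u v s = nonempty? s ⇔-dec (f (u , v) Bool.≟ true)

  meetingOnce? : ∀ u v {k} → Decidable (MeetingOnce u v {k})
  meetingOnce? u v s = meeting? u v s ×-dec atMostOne? s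

  -- The i-th biclique of this labelling is the star of the i-th vertex of U.
  starLabelling : HasLabelling MeetingOnce (2 ^ n)
  starLabelling = S , λ u v → mk⇔ (adjacent u v) (common u v) , atMostOne u v
    where
    module Index = RightInverse (boolVec↪Fin {n})

    S : Label (2 ^ n)
    -- Each `u` carries only its own index, each `v` the indices that decode to its neighbours;
    -- every intersection is thus contained in a singleton.
    S (inj₁ u) = ⁅ Index.to u ⁆
    S (inj₂ v) = tabulate λ i → f (Index.from i , v)

    centre : ∀ u v i → i Subset.∈ S ⟨ u ∩ v ⟩ → i ≡ Index.to u
    centre u v i i∈ = x∈⁅y⁆⇒x≡y _ (p∩q⊆p _ _ i∈)

    label⇔E : ∀ u v → Index.to u Subset.∈ S (inj₂ v) ⇔ E u v
    label⇔E u v = subst (λ x → Index.to u Subset.∈ S (inj₂ v) ⇔ f (x , v) ≡ true)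
      (Index.strictlyInverseʳ u)
      (Bool.T-≡ ⇔-∘ ⇔-sym (T⇔∈-tabulate (λ i → f (Index.from i , v)) (Index.to u)))

    adjacent : ∀ u v → Nonempty (S ⟨ u ∩ v ⟩) → E u v
    adjacent u v (i , i∈) = to (label⇔E u v)
      (subst (Subset._∈ S (inj₂ v)) (centre u v i i∈) (p∩q⊆q _ _ i∈))

    common : ∀ u v → E u v → Nonempty (S ⟨ u ∩ v ⟩)
    common u v uv = Index.to u , x∈p∩q⁺ (x∈⁅x⁆ _ , from (label⇔E u v) uv)

    atMostOne : ∀ u v → AtMostOne (S ⟨ u ∩ v ⟩)
    atMostOne u v i j i∈ j∈ = ≡.trans (centre u v i i∈) (≡.sym (centre u v j j∈))

  -- Labellings and families of bicliques.

  open Biclique using (L; R; complete; Edge)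

  Corresponds : (Fin k → Biclique (realization f)) → Label k → Set
  Corresponds B S = ∀ i u v → Edge (B i) u v ⇔ i Subset.∈ S ⟨ u ∩ v ⟩

  module _ (B : Fin k → Biclique (realization f)) (S : Label k) (B∼S : Corresponds B S) where

    -- Completeness of the bicliques gives adjacency from a common label; covering is exactly the
    -- converse implication.
    covers⇔meeting : Covers (realization f) B ⇔ (∀ u v → Meeting u v (S ⟨ u ∩ v ⟩))
    covers⇔meeting = mk⇔
      (λ cover u v → mk⇔
        (λ { (i , i∈) → uncurry (complete (B i) u v) (from (B∼S i u v) i∈) })
        (map₂ (to (B∼S _ u v)) ∘ cover u v))
      (λ meet u v → map₂ (from (B∼S _ u v)) ∘ from (meet u v))

    -- Two distinct common labels of `u` and `v` would place this pair in two bicliques. Equality of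
    -- indices is decidable, so the negative form of disjointness yields an actual equality.
    disjoint⇔atMostOne : EdgeDisjoint (realization f) B ⇔ (∀ u v → AtMostOne (S ⟨ u ∩ v ⟩))
    disjoint⇔atMostOne = mk⇔
      (λ disjoint u v i j i∈ j∈ → decidable-stable (i ≟ j) λ i≢j →
        disjoint i j i≢j u v (from (B∼S i u v) i∈ , from (B∼S j u v) j∈))
      (λ { one i j i≢j u v (e , e′) →
        i≢j (one u v i j (to (B∼S i u v) e) (to (B∼S j u v) e′)) })

  bicliques→label : (B : Fin k → Biclique (realization f)) → ∃⟨ Corresponds B ⟩
  bicliques→label {k} B = S , λ i u v →
    ⇔-sym ∩⇔× ⇔-∘ (T⇔∈-tabulate _ i ×-⇔ T⇔∈-tabulate _ i)
    where
    S : Label k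
    S (inj₁ u) = tabulate λ i → L (B i) u
    S (inj₂ v) = tabulate λ i → R (B i) v

  -- The meeting hypothesis supplies completeness: a pair sharing the label `i` has a nonempty
  -- intersection and is therefore an edge.
  label→bicliques : (S : Label k) → (∀ u v → Meeting u v (S ⟨ u ∩ v ⟩)) →
                    ∃[ B ] Corresponds B S
  label→bicliques {k} S meet = B , edge⇔∈
    where
    edge⇔∈ : ∀ i u v → (T (lookup (S (inj₁ u)) i) × T (lookup (S (inj₂ v)) i)) ⇔
                       i Subset.∈ S ⟨ u ∩ v ⟩
    edge⇔∈ i u v = ⇔-sym ∩⇔× ⇔-∘ (T-lookup⇔∈ _ i ×-⇔ T-lookup⇔∈ _ i)

    B : Fin k → Biclique (realization f)
    B i = record
      { L        = λ u → lookup (S (inj₁ u)) i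
      ; R        = λ v → lookup (S (inj₂ v)) i
      ; complete = λ u v l r → to (meet u v) (i , to (edge⇔∈ i u v) (l , r))
      }

  labelling⇔cover : HasLabelling Meeting k ⇔ HasBicliqueCover (realization f) k
  labelling⇔cover = mk⇔
    (λ { (S , meet) → let B , B∼S = label→bicliques S meet in
         B , from (covers⇔meeting B S B∼S) meet })
    (λ { (B , cover) → let S , B∼S = bicliques→label B in
         S , to (covers⇔meeting B S B∼S) cover })

  labelling⇔partition : HasLabelling MeetingOnce k ⇔ HasBicliquePartition (realization f) k
  labelling⇔partition = mk⇔
    (λ { (S , valid) →
         let meet u v = proj₁ (valid u v)
             B , B∼S  = label→bicliques S meet
         in B , from (covers⇔meeting B S B∼S) meet
              , from (disjoint⇔atMostOne B S B∼S) (λ u v → proj₂ (valid u v)) })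
    (λ { (B , cover , disjoint) → let S , B∼S = bicliques→label B in
         S , λ u v → to (covers⇔meeting B S B∼S) cover u v
                   , to (disjoint⇔atMostOne B S B∼S) disjoint u v })

-- Coordinate subspaces over a field.

module _ {c ℓ₁ ℓ₂ : Level} (F : HeytingField c ℓ₁ ℓ₂) where
  open LinearAlgebra F
  open HeytingField F using (heytingCommutativeRing; invertible⇒#; #-irrefl)
  open HeytingCommutativeRing heytingCommutativeRing using (commutativeRing)
  open CommutativeRing commutativeRing
    renaming (_+_ to _⊹_) hiding (zero)
  open SemiringSum semiring using (sum; sum-cong-≋; sum-replicate-zero; *-distribʳ-sum)
  open RingProperties ring using (-0#≈0#)
  open import Relation.Binary.Reasoning.Setoid setoid

  -- The difference `1# - 0#` is invertible with inverse `1#`, so `1#` is apart from `0#`, and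
  -- apartness is irreflexive.
  1≉0 : ¬ 1# ≈ 0#
  1≉0 1≈0 = #-irrefl 1≈0 (invertible⇒# (1# , trans (*-identityˡ _) 1-0≈1
                                            , trans (*-identityʳ _) 1-0≈1))
    where
    1-0≈1 : 1# - 0# ≈ 1#
    1-0≈1 = trans (+-congˡ -0#≈0#) (+-identityʳ 1#)

  sum-zero : (t : Vector Carrier k) → (∀ i → t i ≈ 0#) → sum t ≈ 0#
  sum-zero {k} t t≈0 = trans (sum-cong-≋ t≈0) (sum-replicate-zero k)

  standardBasis-diagonal : (i : Fin d) → standardBasis i i ≈ 1#
  standardBasis-diagonal i =
    reflexive (≡.cong (if_then 1# else 0#) (dec-true (i ≟ i) ≡.refl))

  standardBasis-off : {i j : Fin d} → i ≢ j → standardBasis i j ≈ 0#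
  standardBasis-off {i = i} {j} i≢j =
    reflexive (≡.cong (if_then 1# else 0#) (dec-false (i ≟ j) i≢j))

  standardBasis-expansion : (x : Space d) → x ≋ linearCombination x standardBasis
  standardBasis-expansion x zero = sym (begin
    x zero * 1# ⊹ _ ≈⟨ +-cong (*-identityʳ _) (sum-zero _ λ i → zeroʳ (x (suc i))) ⟩
    x zero ⊹ 0#     ≈⟨ +-identityʳ _ ⟩
    x zero          ∎)
  -- `standardBasis (suc i) (suc j)` computes to `standardBasis i j`, so the remaining sum is the
  -- expansion of the tail of `x`.
  standardBasis-expansion x (suc j) = sym (begin
    x zero * 0# ⊹ _ ≈⟨ +-cong (zeroʳ _) (sym (standardBasis-expansion (x ∘ suc) j)) ⟩
    0# ⊹ x (suc j)  ≈⟨ +-identityˡ _ ⟩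
    x (suc j)       ∎)

  Span-resp-≋ : (P : Pred (Space d) p) {x y : Space d} → x ≋ y → y ∈ Span P → x ∈ Span P
  Span-resp-≋ P x≋y (k , a , b , b∈P , y≋) = k , a , b , b∈P , λ j → trans (x≋y j) (y≋ j)

  -- Terms with zero coefficient are dropped, because `Span` requires every vector that occurs to
  -- lie in `P`.
  linearCombination∈Span : (P : Pred (Space d) p) (a : Vector Carrier k) (b : Vector (Space d) k) →
    (∀ i → a i ≈ 0# ⊎ b i ∈ P) → linearCombination a b ∈ Span P
  linearCombination∈Span {k = zero} P a b _ = 0 , (λ ()) , (λ ()) , (λ ()) , λ j → refl
  linearCombination∈Span {k = suc k} P a b ok
    with ok zero | linearCombination∈Span P (a ∘ suc) (b ∘ suc) (ok ∘ suc)
  ... | inj₁ a₀≈0 | rest = Span-resp-≋ P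
    (λ j → trans (+-congʳ (trans (*-congʳ a₀≈0) (zeroˡ _))) (+-identityˡ _)) rest
  ... | inj₂ b₀∈P | m , a′ , b′ , b′∈P , eq =
    suc m , a zero ∷ a′ , b zero ∷ b′ ,
    (λ { zero → b₀∈P ; (suc i) → b′∈P i }) , λ j → +-congˡ (eq j)

  -- The working description of a coordinate subspace: closure properties and intersections can be
  -- checked coordinate by coordinate.
  Supported : Subset d → Pred (Space d) ℓ₁
  Supported S x = ∀ j → j Subset.∉ S → x j ≈ 0#

  standardBasis-supported : {S : Subset d} {i : Fin d} → i Subset.∈ S →
                            standardBasis i ∈ Supported S
  standardBasis-supported {i = i} i∈S j j∉S = standardBasis-off {i = i} λ { ≡.refl → j∉S i∈S }

  Span⊆Supported : (P : Pred (Space d) p) {S : Subset d} →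
                   P ⊆ Supported S → Span P ⊆ Supported S
  Span⊆Supported P P⊆ (k , a , b , b∈P , eq) j j∉S = trans (eq j)
    (sum-zero _ λ i → trans (*-congˡ (P⊆ (b∈P i) j j∉S)) (zeroʳ _))

  -- In the standard expansion of `x` only the coefficients indexed by `S` survive. The general `P`
  -- covers both `StandardVectors S` and the range of a basis.
  Supported⊆Span : (P : Pred (Space d) p) {S : Subset d} →
                   (∀ i → i Subset.∈ S → standardBasis i ∈ P) → Supported S ⊆ Span P
  Supported⊆Span P {S} basis∈P {x} x∈S = Span-resp-≋ P (standardBasis-expansion x)
    (linearCombination∈Span P x standardBasis coefficient)
    where
    coefficient : ∀ i → x i ≈ 0# ⊎ standardBasis i ∈ P
    coefficient i with i ∈? S
    ... | yes i∈S = inj₂ (basis∈P i i∈S)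
    ... | no  i∉S = inj₁ (x∈S i i∉S)

  Span-standard : (S : Subset d) → Span (StandardVectors S) ≐ Supported S
  Span-standard S =
    Span⊆Supported (StandardVectors S) (λ { (i , i∈S , x≋) j j∉S →
      trans (x≋ j) (standardBasis-supported i∈S j j∉S) }) ,
    Supported⊆Span (StandardVectors S) (λ i i∈S → i , i∈S , λ _ → refl)

  -- Membership is the span itself, so standardness holds by the identity; the closure laws pass
  -- through `Supported`.
  coordinateSubspace : Subset d → Subspace d
  coordinateSubspace S = record
    { Member   = Span (StandardVectors S)
    ; resp-≋   = λ x≋y → Span-resp-≋ (StandardVectors S) (sym ∘ x≋y)
    ; 0-closed = supported⇒span λ j _ → refl
    ; +-closed = λ x∈ y∈ → supported⇒span λ j j∉S →
        trans (+-cong (span⇒supported x∈ j j∉S) (span⇒supported y∈ j j∉S)) (+-identityˡ 0#)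
    ; *-closed = λ a x∈ → supported⇒span λ j j∉S →
        trans (*-congˡ (span⇒supported x∈ j j∉S)) (zeroʳ a)
    }
    where
    span⇒supported = λ {x} → proj₁ (Span-standard S) {x}
    supported⇒span = λ {x} → proj₂ (Span-standard S) {x}

  Spans : Subset d → Subspace d → Set _
  Spans S W = Member W ≐ Span (StandardVectors S)

  -- An index outside the intersection of `S` and `S′` lies outside one of them, and deciding
  -- membership in `S` tells which one.
  Spans-∩ : {S S′ : Subset d} {W W′ : Subspace d} → Spans S W → Spans S′ W′ →
            Member W ∩ Member W′ ≐ Supported (S Subset.∩ S′)
  Spans-∩ {S = S} {S′} (W⊆ , ⊆W) (W′⊆ , ⊆W′) =
    (λ { (x∈W , x∈W′) → both (proj₁ (Span-standard S) (W⊆ x∈W))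
                             (proj₁ (Span-standard S′) (W′⊆ x∈W′)) }) ,
    (λ x∈ → ⊆W  (proj₂ (Span-standard S)  λ j j∉ → x∈ j (j∉ ∘ p∩q⊆p S S′)) ,
            ⊆W′ (proj₂ (Span-standard S′) λ j j∉ → x∈ j (j∉ ∘ p∩q⊆q S S′)))
    where
    both : ∀ {x} → x ∈ Supported S → x ∈ Supported S′ → x ∈ Supported (S Subset.∩ S′)
    both x∈S x∈S′ j j∉ with j ∈? S
    ... | yes j∈S = x∈S′ j λ j∈S′ → j∉ (x∈p∩q⁺ (j∈S , j∈S′))
    ... | no  j∉S = x∈S j j∉S

  -- Nontriviality and dimension of a coordinate subspace.

  module _ {Q : Pred (Space d) p} {S : Subset d} (Q≐S : Q ≐ Supported S) where

    -- With `S` empty every coordinate is forced to vanish; an index in `S` gives a standard vector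
    -- with an entry `1#`. Decidability of nonemptiness removes the double negation.
    nonzero⇔nonempty : (¬ Q ≐ Zero) ⇔ Nonempty S
    nonzero⇔nonempty = mk⇔
      (λ Q≢0 → decidable-stable (nonempty? S) λ S-empty → Q≢0
        ( (λ x∈Q j → proj₁ Q≐S x∈Q j λ j∈S → S-empty (j , j∈S))
        , (λ x≋0 → proj₂ Q≐S λ j _ → x≋0 j)))
      (λ { (i , i∈S) (Q⊆0 , _) → 1≉0 (trans (sym (standardBasis-diagonal i))
           (Q⊆0 (proj₂ Q≐S (standardBasis-supported i∈S)) i)) })

    basis⇒dimension : (b : Vector (Space d) k) → LinearlyIndependent b →
      (∀ i → b i ∈ Supported S) → (∀ i → i Subset.∈ S → standardBasis i ∈ Range b) →
      HasDimension Q k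
    basis⇒dimension b independent b∈S basis∈b = b , independent ,
      Supported⊆Span (Range b) basis∈b ∘ proj₁ Q≐S ,
      proj₂ Q≐S ∘ Span⊆Supported (Range b) (λ { (i , x≋) j j∉S → trans (x≋ j) (b∈S i j j∉S) })

    atMostOne⇒line : AtMostOne S → ∃[ k ] (HasDimension Q k × k ≤ 1)
    atMostOne⇒line one with nonempty? S
    ... | no S-empty = 0 ,
      basis⇒dimension (λ ()) (λ _ _ ()) (λ ()) (λ i i∈S → contradiction (i , i∈S) S-empty) ,
      z≤n
    ... | yes (i , i∈S) = 1 ,
      basis⇒dimension (λ _ → standardBasis i) independent
        (λ _ → standardBasis-supported i∈S)
        (λ j j∈S → zero , λ l →
          reflexive (≡.cong (λ j → standardBasis j l) (one j i j∈S i∈S))) ,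
      s≤s z≤n
      where
      independent : LinearlyIndependent {k = 1} (λ _ → standardBasis i)
      independent a a≋0 zero = begin
        a zero                             ≈⟨ *-identityʳ _ ⟨
        a zero * 1#                        ≈⟨ *-congˡ (standardBasis-diagonal i) ⟨
        -- A sum over one index unfolds to its term plus `0#`.
        a zero * standardBasis i i         ≈⟨ +-identityʳ _ ⟨
        a zero * standardBasis i i ⊹ 0#    ≈⟨ a≋0 i ⟩
        0#                                 ∎

  Span-line : {P : Pred (Space d) p} {v x : Space d} →
              P ⊆ (_≋ v) → x ∈ Span P → ∃[ a ] x ≋ a *ᵛ v
  Span-line {v = v} {x} P⊆v (k , a , b , b∈P , x≋) = sum a , λ j → begin
    x j                     ≈⟨ x≋ j ⟩
    sum (λ i → a i * b i j) ≈⟨ sum-cong-≋ (λ i → *-congˡ (P⊆v (b∈P i) j)) ⟩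
    sum (λ i → a i * v j)   ≈⟨ *-distribʳ-sum (v j) a ⟨
    sum a * v j             ∎

  -- Both products rearrange to `a * b * v i * v j`. Expressing proportionality by two by two minors
  -- avoids division and any test whether a coordinate is zero.
  minor-vanishes : {v x y : Space d} {a b : Carrier} → x ≋ a *ᵛ v → y ≋ b *ᵛ v →
                   ∀ i j → x i * y j ≈ x j * y i
  minor-vanishes {v = v} {x} {y} {a} {b} x≋ y≋ i j = begin
    x i * y j             ≈⟨ *-cong (x≋ i) (y≋ j) ⟩
    (a * v i) * (b * v j) ≈⟨ *-comm _ _ ⟩
    (b * v j) * (a * v i) ≈⟨ *-assoc _ _ _ ⟩
    b * (v j * (a * v i)) ≈⟨ *-congˡ (x∙yz≈y∙xz _ _ _) ⟩
    b * (a * (v j * v i)) ≈⟨ x∙yz≈y∙xz _ _ _ ⟩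
    a * (b * (v j * v i)) ≈⟨ *-congˡ (x∙yz≈y∙xz _ _ _) ⟩
    a * (v j * (b * v i)) ≈⟨ *-assoc _ _ _ ⟨
    (a * v j) * (b * v i) ≈⟨ *-cong (x≋ j) (y≋ i) ⟨
    x j * y i             ∎
    where
    open import Algebra.Properties.CommutativeSemigroup *-commutativeSemigroup
      using (x∙yz≈y∙xz)

  Range⊆line : k ≤ 1 → (b : Vector (Space d) k) → ∃[ v ] Range b ⊆ (_≋ v)
  -- Without basis vectors the range is empty, and `0ᵛ` is an arbitrary default.
  Range⊆line z≤n       b = 0ᵛ , λ ()
  Range⊆line (s≤s z≤n) b = b zero , λ { (zero , x≋) → x≋ }

  -- For distinct `i` and `j` in `S`, both standard vectors would be multiples of one `v`; their
  -- minor at `i` and `j` then gives `1#` equal to `0#`.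
  line⇒atMostOne : {Q : Pred (Space d) p} {S : Subset d} → Q ≐ Supported S →
                   ∃[ k ] (HasDimension Q k × k ≤ 1) → AtMostOne S
  line⇒atMostOne Q≐S (_ , (b , _ , Q⊆Span , _) , k≤1) i j i∈S j∈S =
    decidable-stable (i ≟ j) λ i≢j → 1≉0 (begin
      1#                                        ≈⟨ *-identityˡ 1# ⟨
      1# * 1#                                   ≈⟨ *-cong (standardBasis-diagonal i)
                                                          (standardBasis-diagonal j) ⟨
      standardBasis i i * standardBasis j j     ≈⟨ minor-vanishes (proj₂ (multiple i i∈S))
                                                                  (proj₂ (multiple j j∈S)) i j ⟩
      standardBasis i j * standardBasis j i     ≈⟨ *-congʳ (standardBasis-off i≢j) ⟩
      0# * standardBasis j i                    ≈⟨ zeroˡ _ ⟩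
      0#                                        ∎)
    where
    v = proj₁ (Range⊆line k≤1 b)

    multiple : ∀ l → l Subset.∈ _ → ∃[ a ] standardBasis l ≋ a *ᵛ v
    multiple l l∈S = Span-line (proj₂ (Range⊆line k≤1 b))
      (Q⊆Span (proj₂ Q≐S (standardBasis-supported l∈S)))

  -- Labellings and standard realizations.

  module _ {n : ℕ} (f : BooleanFunction n) where
    open BipartiteGraph (realization f)

    module _ (φ : Vertex → Subspace d) (S : Label f d) (spans : ∀ x → Spans (S x) (φ x)) where

      intersection : ∀ u v →
        Member (φ (inj₁ u)) ∩ Member (φ (inj₂ v)) ≐ Supported (S (inj₁ u) Subset.∩ S (inj₂ v))
      intersection u v =
        Spans-∩ {W = φ (inj₁ u)} {φ (inj₂ v)} (spans (inj₁ u)) (spans (inj₂ v))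

      -- Each intersection is the coordinate subspace of the common labels. Keeping `φ` arbitrary
      -- serves both the subspaces built from a labelling and a given realization.
      realizes⇔meeting :
        (∀ u v → (¬ (Member (φ (inj₁ u)) ∩ Member (φ (inj₂ v)) ≐ Zero)) ⇔ E u v) ⇔
        (∀ u v → Nonempty (S (inj₁ u) Subset.∩ S (inj₂ v)) ⇔ E u v)
      realizes⇔meeting = mk⇔
        (λ realizes u v → realizes u v ⇔-∘ ⇔-sym (nonzero⇔nonempty (intersection u v)))
        (λ meet u v → meet u v ⇔-∘ nonzero⇔nonempty (intersection u v))

      lines⇔atMostOne : IntersectionsAtMostLines F f φ ⇔
                        (∀ u v → AtMostOne (S (inj₁ u) Subset.∩ S (inj₂ v)))
      lines⇔atMostOne = mk⇔
        (λ lines u v → line⇒atMostOne (intersection u v) (lines u v))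
        (λ one u v → atMostOne⇒line (intersection u v) (one u v))

    spans : (S : Label f d) (x : Vertex) →
            Spans (S x) (coordinateSubspace (S x))
    spans S x = id , id

    labelling⇔realization : HasLabelling f (Meeting f) d ⇔ HasStandardRealization F f d
    labelling⇔realization = mk⇔
      (λ { (S , meet) → coordinateSubspace ∘ S ,
           (λ x → S x , spans S x) ,
           from (realizes⇔meeting (coordinateSubspace ∘ S) S (spans S)) meet })
      -- The index sets witnessing `IsStandard` form the labelling.
      (λ { (φ , standard , realizes) → proj₁ ∘ standard ,
           to (realizes⇔meeting φ (proj₁ ∘ standard) (proj₂ ∘ standard)) realizes })

    labelling⇔unambiguousRealization :
      HasLabelling f (MeetingOnce f) d ⇔ HasUnambiguousStandardRealization F f d
    labelling⇔unambiguousRealization = mk⇔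
      (λ { (S , valid) → coordinateSubspace ∘ S ,
           ((λ x → S x , spans S x) ,
            from (realizes⇔meeting (coordinateSubspace ∘ S) S (spans S))
                 (λ u v → proj₁ (valid u v))) ,
           from (lines⇔atMostOne (coordinateSubspace ∘ S) S (spans S))
                 (λ u v → proj₂ (valid u v)) })
      (λ { (φ , (standard , realizes) , lines) → proj₁ ∘ standard , λ u v →
           to (realizes⇔meeting φ (proj₁ ∘ standard) (proj₂ ∘ standard)) realizes u v ,
           to (lines⇔atMostOne φ (proj₁ ∘ standard) (proj₂ ∘ standard)) lines u v })

theorem1p4 : ∀ {c ℓ₁ ℓ₂} (F : HeytingField c ℓ₁ ℓ₂) (n : ℕ) (f : BooleanFunction n) →
    (∃[ d ] (IsSpd F f d × IsBc (realization f) d)) ×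
    (∃[ d ] (IsUspd F f d × IsBp (realization f) d))
theorem1p4 F n f =
  let star , valid = starLabelling f
      -- The star labelling starts both searches; for covers its uniqueness half is forgotten.
      d , least  = leastOf (hasLabelling? f (Meeting f) (meeting? f))
                           (2 ^ n , star , λ u v → proj₁ (valid u v))
      d′ , least′ = leastOf (hasLabelling? f (MeetingOnce f) (meetingOnce? f))
                            (2 ^ n , star , valid)
  in (d , isLeast-resp-⇔ (labelling⇔realization F f) least
        , isLeast-resp-⇔ (labelling⇔cover f) least) ,
     (d′ , isLeast-resp-⇔ (labelling⇔unambiguousRealization F f) least′
         , isLeast-resp-⇔ (labelling⇔partition f) least′)
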